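{- There is a constant $K_0$ such that for all $n\ge 2$, every initial BST on $[n]$ and every sequence of $m$ accesses, the Path-Balance algorithm performs the $m$ accesses with total cost at most $K_0\,(n+m)\log_2 n\,\log_2\log_2 n$; that is, Path-Balance has amortized cost $O(\log n\log\log n)$ per access.
   Context: BSTs on keys $[n]$. The Path-Balance algorithm is a minimally self-adjusting BST algorithm: on access to $s$ in the current tree $T$, with search path $P$ (nodes on the root-to-$s$ path, including $s$), it replaces $P$ by a balanced BST on the node set $P$ of depth $\lceil\log_2(1+|P|)\rceil$ rooted at $s$, reattaching the subtrees hanging off $P$ in the unique order-consistent way. The cost of an access is $|P|$.
   Formalization: At n = 2 the stated bound is 0 and fails for m ≥ 1, so log₂ log₂ n is replaced by max(1, ⌈log₂⌈log₂ n⌉⌉) and log₂ n by ⌈log₂ n⌉ (same up to constants for n ≥ 3); the balanced tree may have any depth, in edges, of at most ⌈log₂(1+|P|)⌉. -}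

module Defs where

open import Data.Nat using (ℕ; zero; suc; _+_; _*_; _≤_; _<ᵇ_; _⊔_)
open import Data.Nat.Logarithm using (⌈log₂_⌉)
open import Data.Bool using (if_then_else_)
open import Data.List using (List; []; _∷_; _++_; [_]; length; map; upTo)
open import Data.List.Relation.Unary.All using (All)
open import Data.Maybe using (Maybe; just; nothing)
open import Data.Product using (Σ; _×_; _,_; proj₁; proj₂)
open import Relation.Binary.PropositionalEquality using (_≡_)

data Tree : Set where
  leaf : Tree
  node : Tree → ℕ → Tree → Tree

inorder : Tree → List ℕ
inorder leaf = []
inorder (node l k r) = inorder l ++ k ∷ inorder r

IsBST : ℕ → Tree → Set
IsBST n t = inorder t ≡ map suc (upTo n)

-- Top parts of trees: finite binary trees of keys whose "holes" are the
-- positions where subtrees hang off.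
data Top : Set where
  hole : Top
  node : Top → ℕ → Top → Top

keysTop : Top → List ℕ
keysTop hole = []
keysTop (node l k r) = keysTop l ++ k ∷ keysTop r

rootTop : Top → Maybe ℕ
rootTop hole = nothing
rootTop (node _ k _) = just k

-- height in nodes (hole has height 0); the depth (in edges) of a
-- nonempty top tree is heightTop − 1.
heightTop : Top → ℕ
heightTop hole = 0
heightTop (node l _ r) = suc (heightTop l ⊔ heightTop r)

plug′ : Top → List Tree → Tree × List Tree
plug′ hole [] = leaf , []
plug′ hole (t ∷ ts) = t , ts
plug′ (node l k r) ts with plug′ l ts
... | tl , ts₁ with plug′ r ts₁
...   | tr , ts₂ = node tl k tr , ts₂

plug : Top → List Tree → Tree
plug c ts = proj₁ (plug′ c ts)

-- Search for key s: returns the search path P as a top tree (the nodes of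
-- the root-to-s path, with all the other positions as holes) together with
-- the subtrees hanging off P, in left-to-right order.
split : Tree → ℕ → Top × List Tree
split leaf s = hole , [ leaf ]
split (node l k r) s =
  if s <ᵇ k
  then (node (proj₁ (split l s)) k hole , proj₂ (split l s) ++ [ r ])
  else (if k <ᵇ s
        then (node hole k (proj₁ (split r s)) , l ∷ proj₂ (split r s))
        else (node hole k hole , l ∷ r ∷ []))

accessCost : Tree → ℕ → ℕ
accessCost t s = length (keysTop (proj₁ (split t s)))

-- One Path-Balance step: accessing s in T may yield T′ iff T′ is obtained
-- by replacing the search path P by some BST C′ on the node set P, rooted at
-- s, of depth (in edges) at most ⌈log₂(1+|P|)⌉, and reattaching the subtrees
-- hanging off P in order.
PBStep : Tree → ℕ → Tree → Set
PBStep t s t′ =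
  Σ Top λ c′ →
    (rootTop c′ ≡ just s)
    × (keysTop c′ ≡ keysTop (proj₁ (split t s)))
    × (heightTop c′ ≤ suc ⌈log₂ (suc (accessCost t s)) ⌉)
    × (t′ ≡ plug c′ (proj₂ (split t s)))

-- Run t ss c : executing the access sequence ss with Path-Balance starting
-- from tree t (with some admissible choice of balanced trees) has total cost c.
data Run : Tree → List ℕ → ℕ → Set where
  done : ∀ {t} → Run t [] 0
  step : ∀ {t s t′ ss c} → PBStep t s t′ → Run t′ ss c →
         Run t (s ∷ ss) (accessCost t s + c)

lglg : ℕ → ℕ
lglg n = 1 ⊔ ⌈log₂ ⌈log₂ n ⌉ ⌉

{-# OPTIONS --safe #-}
-- Give a tree the potential Φ = Σ ⌈log₂ weight⌉ over its subtrees, where the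
-- weight counts leaves.  Let R be the part of the new tree to the right of its
-- root s.  Each key of R was, in the old tree, the root of a subtree containing
-- all leaves between s and that key.  Charging 1 + lg a + lg b ≤ 2 lg (a + b)
-- from left to right along each level of R, one finds that the potential of the
-- nodes in R drops by at least their number, up to O(log n) per level; the left
-- part is symmetric.  Hence |P| + ΔΦ = O(log n · log |P|).  This is
-- O(log n · log log n) when log |P| = O(log log n), and otherwise at most |P| / 2.
module Submission where

open import Defs
open import Data.Bool using (true; false; T)
open import Data.Empty using (⊥-elim)
open import Data.Nat using (ℕ; zero; suc; _+_; _*_; _^_; _∸_; _≤_; _<_; _<ᵇ_; z≤n; s≤s; s≤s⁻¹; ⌈_/2⌉; ⌊_/2⌋)
open import Data.Nat.Induction using (<-rec)
open import Data.Nat.ListAction using (sum)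
open import Data.Nat.ListAction.Properties using (sum-++)
open import Data.Nat.Logarithm using (⌈log₂_⌉; ⌈log₂⌉-mono-≤; ⌈log₂2*n⌉≡1+⌈log₂n⌉; ⌈log₂⌈n/2⌉⌉≡⌈log₂n⌉∸1; ⌈log₂2^n⌉≡n)
open import Data.Nat.Properties
open import Data.Nat.Tactic.RingSolver using (solve-∀)
open import Data.List using (List; []; _∷_; _++_; [_]; length; map; upTo; initLast; _∷ʳ′_)
open import Data.List.Properties using (length-++; length-map; length-upTo; map-++; ++-identityʳ; ++-assoc; ∷-injective; ∷-injectiveʳ; ∷ʳ-injective)
open import Data.List.Relation.Unary.All using (All)
open import Data.Maybe.Properties using (just-injective)
open import Data.Product using (Σ; _×_; _,_; proj₁; proj₂; ∃₂)
open import Data.Sum using (inj₁; inj₂)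
open import Data.Unit using (tt)
open import Relation.Binary.PropositionalEquality using (_≡_; refl; sym; trans; cong; cong₂; subst)
open import Relation.Nullary using (yes; no)

open ≤-Reasoning

-- Inequalities for the rounded-up binary logarithm.

lg : ℕ → ℕ
lg = ⌈log₂_⌉

lg-2* : ∀ {m n} → 1 ≤ m → 2 * m ≤ n → 1 + lg m ≤ lg n
lg-2* {suc m} _ 2m≤n = subst (_≤ _) (⌈log₂2*n⌉≡1+⌈log₂n⌉ (suc m)) (⌈log₂⌉-mono-≤ 2m≤n)

-- Twice the smaller summand is at most `a + b`, which gains the `1`; the larger summand only needs
-- monotonicity.
lg-+ : ∀ a b → 1 ≤ a → 1 ≤ b → 1 + lg a + lg b ≤ lg (a + b) + lg (a + b)
lg-+ a b 1≤a 1≤b with ≤-total a b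
... | inj₁ a≤b = +-mono-≤
  (lg-2* 1≤a (+-monoʳ-≤ a (subst (_≤ b) (sym (+-identityʳ a)) a≤b)))
  (⌈log₂⌉-mono-≤ (m≤n+m b a))
... | inj₂ b≤a = subst (_≤ lg (a + b) + lg (a + b)) (+-suc (lg a) (lg b)) (+-mono-≤
  (⌈log₂⌉-mono-≤ (m≤m+n a b))
  (lg-2* 1≤b (+-mono-≤ b≤a (≤-reflexive (+-identityʳ b)))))

n≤2^lg : ∀ n → n ≤ 2 ^ lg n
n≤2^lg = <-rec _ go
  where
  go : ∀ n → (∀ {m} → m < n → m ≤ 2 ^ lg m) → n ≤ 2 ^ lg n
  go 0 _ = z≤n
  go 1 _ = ≤-refl
  go n@(suc (suc k)) ih = begin
    n                                   ≡⟨ sym (⌊n/2⌋+⌈n/2⌉≡n n) ⟩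
    ⌊ n /2⌋ + ⌈ n /2⌉                   ≤⟨ +-mono-≤ (≤-trans (⌊n/2⌋≤⌈n/2⌉ n) half≤) half≤ ⟩
    2 ^ (lg n ∸ 1) + 2 ^ (lg n ∸ 1)     ≡⟨ cong (2 ^ (lg n ∸ 1) +_) (sym (+-identityʳ _)) ⟩
    2 ^ suc (lg n ∸ 1)                  ≡⟨ cong (2 ^_) (m+[n∸m]≡n {1} (⌈log₂⌉-mono-≤ {2} {n} (s≤s (s≤s z≤n)))) ⟩
    2 ^ lg n                            ∎
    where
    half≤ : ⌈ n /2⌉ ≤ 2 ^ (lg n ∸ 1)
    half≤ = subst (λ e → ⌈ n /2⌉ ≤ 2 ^ e) (⌈log₂⌈n/2⌉⌉≡⌈log₂n⌉∸1 n) (ih (⌈n/2⌉<n k))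

m<lg⇒2^m<n : ∀ m n → m < lg n → 2 ^ m < n
m<lg⇒2^m<n m n m<lgn = ≰⇒> λ n≤2^m →
  <⇒≱ m<lgn (subst (lg n ≤_) (⌈log₂2^n⌉≡n m) (⌈log₂⌉-mono-≤ n≤2^m))

1+n≤2^n : ∀ n → suc n ≤ 2 ^ n
1+n≤2^n zero = ≤-refl
1+n≤2^n (suc n) = begin
  1 + suc n              ≤⟨ +-mono-≤ (m^n>0 2 n) (1+n≤2^n n) ⟩
  2 ^ n + 2 ^ n          ≡⟨ cong (2 ^ n +_) (sym (+-identityʳ _)) ⟩
  2 ^ suc n              ∎

64*y≤2^y : ∀ y → 10 ≤ y → 64 * y ≤ 2 ^ y
64*y≤2^y y 10≤y with m≤n⇒∃[o]m+o≡n 10≤y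
... | j , refl = begin
  64 * (10 + j)       ≡⟨ *-distribˡ-+ 64 10 j ⟩
  640 + 64 * j        ≤⟨ +-mono-≤ (m≤m+n 640 384) (*-monoˡ-≤ j (m≤m+n 64 960)) ⟩
  1024 + 1024 * j     ≡⟨ sym (*-suc 1024 j) ⟩
  1024 * suc j        ≤⟨ *-monoʳ-≤ 1024 (1+n≤2^n j) ⟩
  1024 * 2 ^ j        ≡⟨ sym (^-distribˡ-+-* 2 10 j) ⟩
  2 ^ (10 + j)        ∎

-- A short path has `lg (suc p)` of order `λ′`; for a long one, `p` alone exceeds the left side. The
-- coefficient `1` of `p` allows one of two copies of the access cost to absorb it later.
16*lg*ℓ≤ : ∀ p ℓ λ′ → lg ℓ ≤ λ′ → 1 ≤ λ′ → 16 * lg (suc p) * ℓ ≤ p + 192 * (ℓ * λ′)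
16*lg*ℓ≤ p ℓ λ′ lgℓ≤λ 1≤λ with lg (suc p) ≤? λ′ + (λ′ + 10)
... | yes h≤ = begin
  16 * lg (suc p) * ℓ             ≤⟨ *-monoˡ-≤ ℓ (*-monoʳ-≤ 16 h≤) ⟩
  16 * (λ′ + (λ′ + 10)) * ℓ       ≤⟨ *-monoˡ-≤ ℓ (*-monoʳ-≤ 16 (+-monoʳ-≤ λ′ (+-monoʳ-≤ λ′ (*-monoʳ-≤ 10 1≤λ)))) ⟩
  16 * (λ′ + (λ′ + 10 * λ′)) * ℓ  ≡⟨ eq λ′ ℓ ⟩
  192 * (ℓ * λ′)                  ≤⟨ m≤n+m _ p ⟩
  p + 192 * (ℓ * λ′)              ∎
  where
  eq : ∀ x ℓ → 16 * (x + (x + 10 * x)) * ℓ ≡ 192 * (ℓ * x)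
  eq = solve-∀
-- Here `lg (suc p)` is `1 + λ′ + y` with `y ≥ λ′ + 10`, so the left side is at most `64 * y * ℓ`.
-- The `10` gives `64 * y ≤ 2 ^ y`, while `ℓ ≤ 2 ^ λ′` and `2 ^ (λ′ + y) ≤ p`.
... | no h≰ with m≤n⇒∃[o]m+o≡n (≰⇒> h≰)
...   | j , eq = begin
  16 * lg (suc p) * ℓ             ≤⟨ *-monoˡ-≤ ℓ (*-monoʳ-≤ 16 h≤4y) ⟩
  16 * (4 * y) * ℓ                ≡⟨ cong (_* ℓ) (sym (*-assoc 16 4 y)) ⟩
  64 * y * ℓ                      ≤⟨ *-mono-≤ (64*y≤2^y y 10≤y) (≤-trans (n≤2^lg ℓ) (^-monoʳ-≤ 2 lgℓ≤λ)) ⟩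
  2 ^ y * 2 ^ λ′                  ≡⟨ *-comm (2 ^ y) (2 ^ λ′) ⟩
  2 ^ λ′ * 2 ^ y                  ≡⟨ sym (^-distribˡ-+-* 2 λ′ y) ⟩
  2 ^ (λ′ + y)                    ≤⟨ s≤s⁻¹ (m<lg⇒2^m<n (λ′ + y) (suc p) (≤-reflexive h≡)) ⟩
  p                               ≤⟨ m≤m+n p _ ⟩
  p + 192 * (ℓ * λ′)              ∎
  where
  y = λ′ + 10 + j
  h≡ : suc (λ′ + y) ≡ lg (suc p)
  h≡ = trans (cong suc (sym (+-assoc λ′ (λ′ + 10) j))) eq
  10≤y : 10 ≤ y
  10≤y = ≤-trans (m≤n+m 10 λ′) (m≤m+n _ j)
  λ≤y : λ′ ≤ y
  λ≤y = ≤-trans (m≤m+n λ′ 10) (m≤m+n _ j)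
  h≤4y : lg (suc p) ≤ 4 * y
  h≤4y = begin
    lg (suc p)          ≡⟨ sym h≡ ⟩
    suc (λ′ + y)        ≤⟨ +-mono-≤ {1} {y} (≤-trans (s≤s z≤n) 10≤y) (+-mono-≤ λ≤y (m≤m+n y (y + 0))) ⟩
    4 * y               ∎

-- Weights and the potential.

weight : Tree → ℕ
weight leaf = 1
weight (node l _ r) = weight l + weight r

weights : List Tree → ℕ
weights ts = sum (map weight ts)

weights-++ : ∀ ts us → weights (ts ++ us) ≡ weights ts + weights us
weights-++ ts us = trans (cong sum (map-++ weight ts us)) (sum-++ (map weight ts) (map weight us))

weight-pos : ∀ t → 1 ≤ weight t
weight-pos leaf = ≤-refl
weight-pos (node l _ r) = ≤-trans (weight-pos l) (m≤m+n _ _)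

weight-inorder : ∀ t → weight t ≡ suc (length (inorder t))
weight-inorder leaf = refl
weight-inorder (node l k r) = begin-equality
  weight l + weight r                                ≡⟨ cong₂ _+_ (weight-inorder l) (weight-inorder r) ⟩
  suc (length (inorder l) + length (k ∷ inorder r))  ≡⟨ cong suc (sym (length-++ (inorder l))) ⟩
  suc (length (inorder l ++ k ∷ inorder r))          ∎

Φ : Tree → ℕ
Φ leaf = 0
Φ (node l k r) = Φ l + Φ r + lg (weight l + weight r)

Φ≤ : ∀ t M → weight t ≤ M → Φ t ≤ length (inorder t) * lg M
Φ≤ leaf M _ = z≤n
Φ≤ (node l k r) M w≤M = begin
  Φ l + Φ r + lg (weight l + weight r)
    ≤⟨ +-mono-≤ (+-mono-≤ (Φ≤ l M (≤-trans (m≤m+n _ _) w≤M)) (Φ≤ r M (≤-trans (m≤n+m _ _) w≤M))) (⌈log₂⌉-mono-≤ w≤M) ⟩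
  a * lg M + b * lg M + lg M      ≡⟨ eq a b (lg M) ⟩
  (a + suc b) * lg M              ≡⟨ cong (_* lg M) (sym (length-++ (inorder l))) ⟩
  length (inorder l ++ k ∷ inorder r) * lg M ∎
  where
  a = length (inorder l)
  b = length (inorder r)
  eq : ∀ a b x → a * x + b * x + x ≡ (a + suc b) * x
  eq = solve-∀

-- Filling the holes of a top.

-- Relational form of `plug`: cutting the list at each node lets proofs treat both children
-- independently, without the remainder that `plug′` threads through.
data Fill : Top → List Tree → Tree → Set where
  hole : ∀ {t} → Fill hole [ t ] t
  node : ∀ {l r k ts us tl tr} → Fill l ts tl → Fill r us tr →
         Fill (node l k r) (ts ++ us) (node tl k tr)

++-split : ∀ {A : Set} m {n} (xs : List A) → length xs ≡ m + n →
           ∃₂ λ ys zs → xs ≡ ys ++ zs × length ys ≡ m × length zs ≡ n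
++-split zero xs eq = [] , xs , refl , refl , eq
++-split (suc m) (x ∷ xs) eq with ++-split m xs (suc-injective eq)
... | ys , zs , refl , e₁ , e₂ = x ∷ ys , zs , refl , cong suc e₁ , e₂

-- A top has one hole more than keys, so exactly `ts` is consumed. The remainder `us` is there for
-- the induction: the left child is also handed the trees of the right child.
fill-plug′ : ∀ c ts us → length ts ≡ suc (length (keysTop c)) →
             Fill c ts (proj₁ (plug′ c (ts ++ us))) × proj₂ (plug′ c (ts ++ us)) ≡ us
fill-plug′ hole (t ∷ []) us _ = hole , refl
fill-plug′ (node l k r) ts us eq
  with ++-split (suc (length (keysTop l))) ts (trans eq (cong suc (length-++ (keysTop l))))
... | ts₁ , ts₂ , refl , e₁ , e₂ rewrite ++-assoc ts₁ ts₂ us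
  with plug′ l (ts₁ ++ (ts₂ ++ us)) | fill-plug′ l ts₁ (ts₂ ++ us) e₁
... | tl , _ | f₁ , refl
  with plug′ r (ts₂ ++ us) | fill-plug′ r ts₂ us e₂
... | tr , _ | f₂ , refl = node f₁ f₂ , refl

fill-weight : ∀ {c ts t} → Fill c ts t → weight t ≡ weights ts
fill-weight (hole {t}) = sym (+-identityʳ (weight t))
fill-weight (node {ts = ts} {us} f g) =
  trans (cong₂ _+_ (fill-weight f) (fill-weight g)) (sym (weights-++ ts us))

-- Charging a rebuilt side to prefixes and suffixes.

-- Potential of the hanging trees, plus lg of the weight of every nonempty
-- initial segment, where b is the weight already present to the left.
prefixΦ : ℕ → List Tree → ℕ
prefixΦ b [] = 0
prefixΦ b (t ∷ ts) = Φ t + lg (b + weight t) + prefixΦ (b + weight t) ts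

-- Mirror image for the left of `s`: final segments replace initial ones, and `b` is the weight to
-- the right of the list.
suffixΦ : ℕ → List Tree → ℕ
suffixΦ b [] = 0
suffixΦ b (t ∷ ts) = Φ t + lg (b + weights (t ∷ ts)) + suffixΦ b ts

prefixΦ-++ : ∀ b ts us → prefixΦ b (ts ++ us) ≡ prefixΦ b ts + prefixΦ (b + weights ts) us
prefixΦ-++ b [] us = cong (λ x → prefixΦ x us) (sym (+-identityʳ b))
prefixΦ-++ b (t ∷ ts) us = trans
  (cong (Φ t + lg (b + weight t) +_)
    (trans (prefixΦ-++ (b + weight t) ts us)
           (cong (λ x → prefixΦ (b + weight t) ts + prefixΦ x us) (+-assoc b (weight t) (weights ts)))))
  (sym (+-assoc (Φ t + lg (b + weight t)) _ _))

suffixΦ-++ : ∀ b ts us → suffixΦ b (ts ++ us) ≡ suffixΦ (b + weights us) ts + suffixΦ b us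
suffixΦ-++ b [] us = refl
suffixΦ-++ b (t ∷ ts) us = trans
  (cong₂ (λ x y → Φ t + lg x + y)
    (trans (cong (b +_) (weights-++ (t ∷ ts) us)) (eq b (weights (t ∷ ts)) (weights us)))
    (suffixΦ-++ b ts us))
  (sym (+-assoc (Φ t + lg (b + weights us + weights (t ∷ ts))) _ _))
  where
  eq : ∀ b x y → b + (x + y) ≡ b + y + x
  eq = solve-∀

-- The root of a subtree of weight w with near end b, root position m, and far
-- end e = b + w.
root-charge : ∀ b m e w → 1 ≤ b → 1 ≤ w → b ≤ m → b + w ≡ e →
              1 + lg w + 2 * lg b ≤ 2 * lg e + lg m
root-charge b m _ w 1≤b 1≤w b≤m refl = begin
  1 + lg w + 2 * lg b                ≡⟨ eq₁ (lg w) (lg b) ⟩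
  (1 + lg b + lg w) + lg b           ≤⟨ +-mono-≤ (lg-+ b w 1≤b 1≤w) (⌈log₂⌉-mono-≤ b≤m) ⟩
  lg (b + w) + lg (b + w) + lg m     ≡⟨ cong (_+ lg m) (cong (lg (b + w) +_) (sym (+-identityʳ _))) ⟩
  2 * lg (b + w) + lg m              ∎
  where
  eq₁ : ∀ w b → 1 + w + 2 * b ≡ (1 + b + w) + b
  eq₁ = solve-∀

-- Adding the three hypotheses cancels `M`, by telescoping at the boundary of the two children, and
-- `m`, the spare logarithm of the first child, which pays for the root. The terms `2 * b` and
-- `2 * e` belong to the root's own level.
charge-node : ∀ n₁ n₂ φ₁ φ₂ F₁ F₂ B M E b m e w →
  n₁ + φ₁ + B + m ≤ F₁ + M →
  n₂ + φ₂ + M + e ≤ F₂ + E →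
  1 + w + 2 * b ≤ 2 * e + m →
  suc (n₁ + n₂) + (φ₁ + φ₂ + w) + (2 * b + B) + e ≤ F₁ + F₂ + (2 * e + E)
charge-node n₁ n₂ φ₁ φ₂ F₁ F₂ B M E b m e w p q r = +-cancelʳ-≤ (M + m) _ _ (begin
  suc (n₁ + n₂) + (φ₁ + φ₂ + w) + (2 * b + B) + e + (M + m)
    ≡⟨ eq₁ n₁ n₂ φ₁ φ₂ B M b m e w ⟩
  (n₁ + φ₁ + B + m) + (n₂ + φ₂ + M + e) + (1 + w + 2 * b)
    ≤⟨ +-mono-≤ (+-mono-≤ p q) r ⟩
  (F₁ + M) + (F₂ + E) + (2 * e + m)
    ≡⟨ eq₂ F₁ F₂ M E m e ⟩
  F₁ + F₂ + (2 * e + E) + (M + m) ∎)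
  where
  eq₁ : ∀ n₁ n₂ φ₁ φ₂ B M b m e w →
    suc (n₁ + n₂) + (φ₁ + φ₂ + w) + (2 * b + B) + e + (M + m) ≡
    (n₁ + φ₁ + B + m) + (n₂ + φ₂ + M + e) + (1 + w + 2 * b)
  eq₁ = solve-∀
  eq₂ : ∀ F₁ F₂ M E m e →
    (F₁ + M) + (F₂ + E) + (2 * e + m) ≡ F₁ + F₂ + (2 * e + E) + (M + m)
  eq₂ = solve-∀

charge-hole : ∀ h b t → Φ t + h * (2 * lg b) + lg (b + weight t)
  ≤ Φ t + lg (b + weight t) + 0 + h * (2 * lg (b + weight t))
charge-hole h b t = begin
  Φ t + h * (2 * lg b) + lg e                ≤⟨ +-monoˡ-≤ (lg e) (+-monoʳ-≤ (Φ t) (*-monoʳ-≤ h (*-monoʳ-≤ 2 (⌈log₂⌉-mono-≤ (m≤m+n b _))))) ⟩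
  Φ t + h * (2 * lg e) + lg e                ≡⟨ eq (Φ t) (h * (2 * lg e)) (lg e) ⟩
  Φ t + lg e + 0 + h * (2 * lg e)            ∎
  where
  e = b + weight t
  eq : ∀ x y z → x + y + z ≡ x + z + 0 + y
  eq = solve-∀

-- Along one level the charges of `root-charge` telescope to at most `2 * lg (b + weight t)` minus
-- `2 * lg b`, gaps being covered by monotonicity; there are at most `h` levels. Since holes
-- outnumber keys by one, the longest prefix stays uncharged: it is the last summand on the left,
-- and pays for the parent of a left child.
fill-prefixΦ : ∀ {c ts t} h b → 1 ≤ b → Fill c ts t → heightTop c ≤ h →
  length (keysTop c) + Φ t + h * (2 * lg b) + lg (b + weight t)
    ≤ prefixΦ b ts + h * (2 * lg (b + weight t))
fill-prefixΦ h b 1≤b (hole {t}) _ = charge-hole h b t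
fill-prefixΦ (suc h) b 1≤b (node {l} {r} {k} {ts} {us} {tl} {tr} f g) (s≤s hc)
  rewrite length-++ (keysTop l) {k ∷ keysTop r}
        | +-suc (length (keysTop l)) (length (keysTop r))
        | prefixΦ-++ b ts us
        | sym (fill-weight f)
        | sym (+-assoc b (weight tl) (weight tr))
  = charge-node (length (keysTop l)) _ (Φ tl) _ (prefixΦ b ts) _ _ _ _ (lg b) _ (lg (b + weight tl + weight tr)) _
      (fill-prefixΦ h b 1≤b f (m⊔n≤o⇒m≤o _ _ hc))
      (fill-prefixΦ h (b + weight tl) (≤-trans 1≤b (m≤m+n _ _)) g (m⊔n≤o⇒n≤o (heightTop l) _ hc))
      (root-charge b (b + weight tl) _ (weight tl + weight tr) 1≤b
        (weight-pos (node tl k tr)) (m≤m+n b _) (sym (+-assoc b _ _)))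

-- The same sweep from right to left; the commutativity rewrites swap the children so that
-- `charge-node` applies with the right child first.
fill-suffixΦ : ∀ {c ts t} h b → 1 ≤ b → Fill c ts t → heightTop c ≤ h →
  length (keysTop c) + Φ t + h * (2 * lg b) + lg (b + weight t)
    ≤ suffixΦ b ts + h * (2 * lg (b + weight t))
fill-suffixΦ h b 1≤b (hole {t}) _ rewrite +-identityʳ (weight t) = charge-hole h b t
fill-suffixΦ (suc h) b 1≤b (node {l} {r} {k} {ts} {us} {tl} {tr} f g) (s≤s hc)
  rewrite length-++ (keysTop l) {k ∷ keysTop r}
        | +-comm (length (keysTop l)) (suc (length (keysTop r)))
        | suffixΦ-++ b ts us
        | sym (fill-weight g)
        | +-comm (suffixΦ (b + weight tr) ts) (suffixΦ b us)
        | +-comm (Φ tl) (Φ tr)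
        | +-comm (weight tl) (weight tr)
        | sym (+-assoc b (weight tr) (weight tl))
  = charge-node (length (keysTop r)) _ (Φ tr) _ (suffixΦ b us) _ _ _ _ (lg b) _ (lg (b + weight tr + weight tl)) _
      (fill-suffixΦ h b 1≤b g (m⊔n≤o⇒n≤o (heightTop l) _ hc))
      (fill-suffixΦ h (b + weight tr) (≤-trans 1≤b (m≤m+n _ _)) f (m⊔n≤o⇒m≤o _ _ hc))
      (root-charge b (b + weight tr) _ (weight tr + weight tl) 1≤b
        (weight-pos (node tr k tl)) (m≤m+n b _) (sym (+-assoc b _ _)))

-- The search path in the old tree.

-- Each side of `s` has one hanging tree more than path keys, so its longest segment has no path
-- node to pay for it; these are the two extra logarithms in `potential`.
record PathSplit (t : Tree) (ts : List Tree) (a b : ℕ) : Set where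
  constructor pathSplit
  field
    xs ys    : List Tree
    hanging  : ts ≡ xs ++ ys
    lengthˡ  : length xs ≡ suc a
    lengthʳ  : length ys ≡ suc b
    weight≡  : weight t ≡ weights xs + weights ys
    potential : suffixΦ 1 xs + prefixΦ 1 ys ≤ Φ t + lg (1 + weights xs) + lg (1 + weights ys)

weights-pos : ∀ ts {n} → length ts ≡ suc n → 1 ≤ weights ts
weights-pos (t ∷ ts) _ = ≤-trans (weight-pos t) (m≤m+n _ _)

-- Induction down the path. Passing `k` adds a hanging tree at the outer end of one side. The
-- subtree at `k` contains the previously longest segment of that side and at least one leaf of the
-- other, so its logarithm pays for that segment with base `1`; the new longest segment becomes the
-- unpaid one.
split-path : ∀ t s L R → keysTop (proj₁ (split t s)) ≡ L ++ s ∷ R →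
             PathSplit t (proj₂ (split t s)) (length L) (length R)
split-path leaf s [] R ()
split-path leaf s (_ ∷ L) R ()
split-path (node l k r) s L R eq with s <ᵇ k in s<ᵇk
split-path (node l k r) s L R eq | true with initLast R
-- Without keys after `s`, the last path key `k` would equal `s`, against `s < k`.
... | [] = ⊥-elim (<-irrefl (sym (proj₂ (∷ʳ-injective _ L eq))) (<ᵇ⇒< s k (subst T (sym s<ᵇk) tt)))
... | R′ ∷ʳ′ k′ with split-path l s L R′ (proj₁ (∷ʳ-injective _ (L ++ s ∷ R′) (trans eq (sym (++-assoc L (s ∷ R′) [ k′ ])))))
...   | pathSplit xs ys e ex ey w p = pathSplit xs (ys ++ [ r ])
  (trans (cong (_++ [ r ]) e) (++-assoc xs ys [ r ]))
  ex
  (trans (length-++ ys) (trans (cong (_+ 1) ey) (cong suc (sym (length-++ R′)))))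
  (trans (cong (_+ weight r) w) (trans (+-assoc (weights xs) (weights ys) (weight r)) (cong (weights xs +_) (sym w′))))
  (begin
    suffixΦ 1 xs + prefixΦ 1 (ys ++ [ r ])
      ≡⟨ cong (suffixΦ 1 xs +_) (prefixΦ-++ 1 ys [ r ]) ⟩
    suffixΦ 1 xs + (prefixΦ 1 ys + (Φ r + lg (1 + weights ys + weight r) + 0))
      ≡⟨ eq₁ (suffixΦ 1 xs) (prefixΦ 1 ys) (Φ r) (lg (1 + weights ys + weight r)) ⟩
    suffixΦ 1 xs + prefixΦ 1 ys + (Φ r + lg (1 + weights ys + weight r))
      ≤⟨ +-monoˡ-≤ _ p ⟩
    Φ l + lg (1 + weights xs) + lg (1 + weights ys) + (Φ r + lg (1 + weights ys + weight r))
      ≤⟨ +-monoˡ-≤ _ (+-monoʳ-≤ (Φ l + lg (1 + weights xs)) (⌈log₂⌉-mono-≤ W≥)) ⟩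
    Φ l + lg (1 + weights xs) + lg (weight l + weight r) + (Φ r + lg (1 + weights ys + weight r))
      ≡⟨ eq₂ (Φ l) (Φ r) (lg (1 + weights xs)) (lg (weight l + weight r)) (lg (1 + weights ys + weight r)) ⟩
    Φ l + Φ r + lg (weight l + weight r) + lg (1 + weights xs) + lg (1 + weights ys + weight r)
      ≡⟨ cong (λ x → Φ (node l k r) + lg (1 + weights xs) + lg (1 + x)) (sym w′) ⟩
    Φ (node l k r) + lg (1 + weights xs) + lg (1 + weights (ys ++ [ r ])) ∎)
  where
  w′ : weights (ys ++ [ r ]) ≡ weights ys + weight r
  w′ = trans (weights-++ ys [ r ]) (cong (weights ys +_) (+-identityʳ (weight r)))
  W≥ : 1 + weights ys ≤ weight l + weight r
  W≥ = ≤-trans (+-monoˡ-≤ (weights ys) (weights-pos xs ex))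
         (≤-trans (≤-reflexive (sym w)) (m≤m+n _ _))
  eq₁ : ∀ a b c d → a + (b + (c + d + 0)) ≡ a + b + (c + d)
  eq₁ = solve-∀
  eq₂ : ∀ a b c d e → a + c + d + (b + e) ≡ a + b + d + c + e
  eq₂ = solve-∀
split-path (node l k r) s L R eq | false with k <ᵇ s in k<ᵇs
split-path (node l k r) s [] R eq | false | true =
  ⊥-elim (<-irrefl (proj₁ (∷-injective eq)) (<ᵇ⇒< k s (subst T (sym k<ᵇs) tt)))
split-path (node l k r) s (_ ∷ L) R eq | false | true with split-path r s L R (∷-injectiveʳ eq)
... | pathSplit xs ys e ex ey w p = pathSplit (l ∷ xs) ys
  (cong (l ∷_) e)
  (cong suc ex)
  ey
  (trans (cong (weight l +_) w) (sym (+-assoc (weight l) (weights xs) (weights ys))))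
  (begin
    Φ l + X + suffixΦ 1 xs + prefixΦ 1 ys
      ≡⟨ +-assoc (Φ l + X) _ _ ⟩
    Φ l + X + (suffixΦ 1 xs + prefixΦ 1 ys)
      ≤⟨ +-monoʳ-≤ (Φ l + X) p ⟩
    Φ l + X + (Φ r + lg (1 + weights xs) + lg (1 + weights ys))
      ≤⟨ +-monoʳ-≤ (Φ l + X) (+-monoˡ-≤ (lg (1 + weights ys)) (+-monoʳ-≤ (Φ r) (⌈log₂⌉-mono-≤ W≥))) ⟩
    Φ l + X + (Φ r + lg (weight l + weight r) + lg (1 + weights ys))
      ≡⟨ eq₁ (Φ l) (Φ r) X (lg (weight l + weight r)) (lg (1 + weights ys)) ⟩
    Φ l + Φ r + lg (weight l + weight r) + X + lg (1 + weights ys) ∎)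
  where
  X = lg (1 + weights (l ∷ xs))
  W≥ : 1 + weights xs ≤ weight l + weight r
  W≥ = begin
    1 + weights xs            ≡⟨ +-comm 1 (weights xs) ⟩
    weights xs + 1            ≤⟨ +-monoʳ-≤ (weights xs) (weights-pos ys ey) ⟩
    weights xs + weights ys   ≡⟨ sym w ⟩
    weight r                  ≤⟨ m≤n+m _ _ ⟩
    weight l + weight r       ∎
  eq₁ : ∀ a b x d y → a + x + (b + d + y) ≡ a + b + d + x + y
  eq₁ = solve-∀
split-path (node l k r) s [] [] eq | false | false = pathSplit [ l ] [ r ] refl refl refl
  (cong₂ _+_ (sym (+-identityʳ (weight l))) (sym (+-identityʳ (weight r))))
  (begin
    Φ l + lg (1 + (weight l + 0)) + 0 + (Φ r + lg (1 + weight r) + 0)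
      ≡⟨ cong (λ x → Φ l + lg (1 + (weight l + 0)) + 0 + (Φ r + lg (1 + x) + 0)) (sym (+-identityʳ (weight r))) ⟩
    Φ l + lg (1 + (weight l + 0)) + 0 + (Φ r + lg (1 + (weight r + 0)) + 0)
      -- At `s` the two single-tree segments are exactly the unpaid ones, so the logarithm of its
      -- own weight is surplus.
      ≤⟨ m≤m+n _ (lg (weight l + weight r)) ⟩
    Φ l + lg (1 + (weight l + 0)) + 0 + (Φ r + lg (1 + (weight r + 0)) + 0) + lg (weight l + weight r)
      ≡⟨ eq₁ (Φ l) (Φ r) (lg (1 + (weight l + 0))) (lg (1 + (weight r + 0))) (lg (weight l + weight r)) ⟩
    Φ l + Φ r + lg (weight l + weight r) + lg (1 + (weight l + 0)) + lg (1 + (weight r + 0)) ∎)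
  where
  eq₁ : ∀ a b x y z → a + x + 0 + (b + y + 0) + z ≡ a + b + z + x + y
  eq₁ = solve-∀
split-path (node l k r) s [] (_ ∷ _) () | false | false
split-path (node l k r) s (_ ∷ []) R () | false | false
split-path (node l k r) s (_ ∷ _ ∷ _) R () | false | false

-- Amortized cost of a single access.

-- Both sides of the new root have height at most `h`, and each costs at most `h * (2 * lgW)`, hence
-- the `4`; `1 + lg (weight t)` is for the root itself. The two logarithms that the old path leaves
-- unpaid are those left uncharged on the new sides, so they cancel.
PBStep-amortized : ∀ {t s t′} → PBStep t s t′ →
  weight t′ ≡ weight t ×
  accessCost t s + Φ t′ ≤ Φ t + (1 + lg (weight t) + 4 * (lg (suc (accessCost t s)) * lg (weight t)))
PBStep-amortized (hole , () , _)
PBStep-amortized {t} {s} (node cL k cR , root , keys , height , refl)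
  with just-injective root
... | refl with split-path t s (keysTop cL) (keysTop cR) (sym keys)
... | pathSplit xs ys e ex ey w p rewrite e
  with plug′ cL (xs ++ ys) | fill-plug′ cL xs ys ex
... | tl , _ | f , refl
  with plug′ cR ys | subst (λ us → Fill cR ys (proj₁ (plug′ cR us))) (++-identityʳ ys) (proj₁ (fill-plug′ cR ys [] ey))
... | tr , _ | g = w≡ , +-cancelʳ-≤ (lg (1 + weight tl) + lg (1 + weight tr)) _ _ (begin
  accessCost t s + (Φ tl + Φ tr + lg (weight tl + weight tr)) + (lg (1 + weight tl) + lg (1 + weight tr))
    ≡⟨ cong₂ (λ c u → c + (Φ tl + Φ tr + lg u) + (lg (1 + weight tl) + lg (1 + weight tr)))
         (trans (cong length (sym keys)) (length-++ (keysTop cL))) w≡ ⟩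
  nL + suc nR + (Φ tl + Φ tr + lgW) + (lg (1 + weight tl) + lg (1 + weight tr))
    -- Both sweeps start from base `1`, and `h * 0` is `h * (2 * lg 1)`.
    ≡⟨ eq₁ nL nR (Φ tl) (Φ tr) lgW (lg (1 + weight tl)) (lg (1 + weight tr)) h ⟩
  (nL + Φ tl + h * 0 + lg (1 + weight tl)) + (nR + Φ tr + h * 0 + lg (1 + weight tr)) + (1 + lgW)
    ≤⟨ +-monoˡ-≤ (1 + lgW) (+-mono-≤ (fill-suffixΦ h 1 ≤-refl f (m⊔n≤o⇒m≤o _ _ (s≤s⁻¹ height)))
                                     (fill-prefixΦ h 1 ≤-refl g (m⊔n≤o⇒n≤o (heightTop cL) _ (s≤s⁻¹ height)))) ⟩
  (suffixΦ 1 xs + h * (2 * lg (1 + weight tl))) + (prefixΦ 1 ys + h * (2 * lg (1 + weight tr))) + (1 + lgW)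
    ≤⟨ +-monoˡ-≤ (1 + lgW) (+-mono-≤ (+-monoʳ-≤ (suffixΦ 1 xs) (*-monoʳ-≤ h (*-monoʳ-≤ 2 (⌈log₂⌉-mono-≤ wl<W))))
                                     (+-monoʳ-≤ (prefixΦ 1 ys) (*-monoʳ-≤ h (*-monoʳ-≤ 2 (⌈log₂⌉-mono-≤ wr<W))))) ⟩
  (suffixΦ 1 xs + h * (2 * lgW)) + (prefixΦ 1 ys + h * (2 * lgW)) + (1 + lgW)
    ≡⟨ eq₂ (suffixΦ 1 xs) (prefixΦ 1 ys) h lgW ⟩
  suffixΦ 1 xs + prefixΦ 1 ys + (1 + lgW + 4 * (h * lgW))
    ≤⟨ +-monoˡ-≤ _ p ⟩
  Φ t + lg (1 + weights xs) + lg (1 + weights ys) + (1 + lgW + 4 * (h * lgW))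
    ≡⟨ cong₂ (λ u v → Φ t + lg (1 + u) + lg (1 + v) + (1 + lgW + 4 * (h * lgW))) (sym (fill-weight f)) (sym (fill-weight g)) ⟩
  Φ t + lg (1 + weight tl) + lg (1 + weight tr) + (1 + lgW + 4 * (h * lgW))
    ≡⟨ eq₃ (Φ t) (lg (1 + weight tl)) (lg (1 + weight tr)) (1 + lgW + 4 * (h * lgW)) ⟩
  Φ t + (1 + lgW + 4 * (h * lgW)) + (lg (1 + weight tl) + lg (1 + weight tr)) ∎)
  where
  h = lg (suc (accessCost t s))
  lgW = lg (weight t)
  nL = length (keysTop cL)
  nR = length (keysTop cR)
  w≡ : weight tl + weight tr ≡ weight t
  w≡ = trans (cong₂ _+_ (fill-weight f) (fill-weight g)) (sym w)
  wl<W : 1 + weight tl ≤ weight t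
  wl<W = ≤-trans (+-monoˡ-≤ (weight tl) (weight-pos tr)) (≤-reflexive (trans (+-comm (weight tr) _) w≡))
  wr<W : 1 + weight tr ≤ weight t
  wr<W = ≤-trans (+-monoˡ-≤ (weight tr) (weight-pos tl)) (≤-reflexive w≡)
  eq₁ : ∀ a b φ₁ φ₂ x y z h → a + suc b + (φ₁ + φ₂ + x) + (y + z) ≡
    (a + φ₁ + h * 0 + y) + (b + φ₂ + h * 0 + z) + (1 + x)
  eq₁ = solve-∀
  eq₂ : ∀ a b h x → (a + h * (2 * x)) + (b + h * (2 * x)) + (1 + x) ≡ a + b + (1 + x + 4 * (h * x))
  eq₂ = solve-∀
  eq₃ : ∀ a b c d → a + b + c + d ≡ a + d + (b + c)
  eq₃ = solve-∀

-- Doubling the amortized inequality yields two copies of the access cost: one absorbs the `p` from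
-- `16*lg*ℓ≤`, the other remains. The constant is `192 + 6`, with `6 * ℓ` from `2 * (ℓ + 2 * ℓ)`.
PBStep-bound : ∀ {t s t′} ℓ λ′ → lg (weight t) ≤ 2 * ℓ → 1 ≤ ℓ → lg ℓ ≤ λ′ → 1 ≤ λ′ → PBStep t s t′ →
  accessCost t s + 2 * Φ t′ ≤ 2 * Φ t + 198 * (ℓ * λ′)
PBStep-bound {t} {s} {t′} ℓ λ′ lgW≤ 1≤ℓ lgℓ≤λ 1≤λ st = +-cancelʳ-≤ p _ _ (begin
  p + 2 * Φ t′ + p                                        ≡⟨ eq₁ p (Φ t′) ⟩
  2 * (p + Φ t′)                                          ≤⟨ *-monoʳ-≤ 2 (proj₂ (PBStep-amortized {t} {s} st)) ⟩
  2 * (Φ t + (1 + lg (weight t) + 4 * (h * lg (weight t)))) ≤⟨ *-monoʳ-≤ 2 (+-monoʳ-≤ (Φ t)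
    (+-mono-≤ (+-mono-≤ 1≤ℓ lgW≤) (*-monoʳ-≤ 4 (*-monoʳ-≤ h lgW≤)))) ⟩
  2 * (Φ t + (ℓ + 2 * ℓ + 4 * (h * (2 * ℓ))))             ≡⟨ eq₂ (Φ t) ℓ h ⟩
  2 * Φ t + (6 * (ℓ * 1) + 16 * h * ℓ)                    ≤⟨ +-monoʳ-≤ (2 * Φ t)
    (+-mono-≤ (*-monoʳ-≤ 6 (*-monoʳ-≤ ℓ 1≤λ)) (16*lg*ℓ≤ p ℓ λ′ lgℓ≤λ 1≤λ)) ⟩
  2 * Φ t + (6 * (ℓ * λ′) + (p + 192 * (ℓ * λ′)))         ≡⟨ eq₃ (Φ t) (ℓ * λ′) p ⟩
  2 * Φ t + 198 * (ℓ * λ′) + p                            ∎)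
  where
  p = accessCost t s
  h = lg (suc p)
  eq₁ : ∀ p x → p + 2 * x + p ≡ 2 * (p + x)
  eq₁ = solve-∀
  eq₂ : ∀ x l h → 2 * (x + (l + 2 * l + 4 * (h * (2 * l)))) ≡ 2 * x + (6 * (l * 1) + 16 * h * l)
  eq₂ = solve-∀
  eq₃ : ∀ x y p → 2 * x + (6 * y + (p + 192 * y)) ≡ 2 * x + 198 * y + p
  eq₃ = solve-∀

-- Summing over an access sequence.

-- The potentials telescope; each step preserves the weight, so the bound on its logarithm persists.
Run-bound : ∀ {t ss c} ℓ λ′ → lg (weight t) ≤ 2 * ℓ → 1 ≤ ℓ → lg ℓ ≤ λ′ → 1 ≤ λ′ → Run t ss c →
  c ≤ 2 * Φ t + length ss * (198 * (ℓ * λ′))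
Run-bound ℓ λ′ _ _ _ _ done = z≤n
Run-bound ℓ λ′ lgW≤ 1≤ℓ lgℓ≤λ 1≤λ (step {t} {s} {t′} {ss} {c} st run) = begin
  accessCost t s + c
    ≤⟨ +-monoʳ-≤ (accessCost t s) (Run-bound ℓ λ′ (subst (λ w → lg w ≤ 2 * ℓ) (sym (proj₁ (PBStep-amortized {t} {s} st))) lgW≤) 1≤ℓ lgℓ≤λ 1≤λ run) ⟩
  accessCost t s + (2 * Φ t′ + length ss * K)   ≡⟨ sym (+-assoc (accessCost t s) _ _) ⟩
  accessCost t s + 2 * Φ t′ + length ss * K     ≤⟨ +-monoˡ-≤ _ (PBStep-bound {t} {s} ℓ λ′ lgW≤ 1≤ℓ lgℓ≤λ 1≤λ st) ⟩
  2 * Φ t + K + length ss * K                   ≡⟨ +-assoc (2 * Φ t) K _ ⟩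
  2 * Φ t + suc (length ss) * K                 ∎
  where
  K = 198 * (ℓ * λ′)

lg-suc : ∀ n → 2 ≤ n → lg (suc n) ≤ 2 * lg n
lg-suc n@(suc n-1) 2≤n = begin
  lg (suc n)      ≤⟨ ⌈log₂⌉-mono-≤ (≤-trans (+-monoˡ-≤ n (≤-trans (s≤s z≤n) 2≤n)) (+-monoʳ-≤ n (m≤m+n n 0))) ⟩
  lg (2 * n)      ≡⟨ ⌈log₂2*n⌉≡1+⌈log₂n⌉ n ⟩
  1 + lg n        ≤⟨ +-mono-≤ (⌈log₂⌉-mono-≤ 2≤n) (m≤m+n (lg n) 0) ⟩
  2 * lg n        ∎

theorem5 : Σ ℕ λ K₀ →
    (n : ℕ) → 2 ≤ n →
    (t : Tree) → IsBST n t →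
    (ss : List ℕ) → All (λ s → 1 ≤ s × s ≤ n) ss →
    (c : ℕ) → Run t ss c →
    c ≤ K₀ * (n + length ss) * ⌈log₂ n ⌉ * lglg n
theorem5 = 198 , λ n 2≤n t bst ss _ c run →
  let
    ℓ  = lg n
    λ′ = lglg n
    m  = length ss
    1≤λ : 1 ≤ λ′
    1≤λ = m≤m⊔n 1 (lg ℓ)
    size : length (inorder t) ≡ n
    size = trans (cong length bst) (trans (length-map suc (upTo n)) (length-upTo n))
    weight≡ : weight t ≡ suc n
    weight≡ = trans (weight-inorder t) (cong suc size)
    lgW≤ : lg (weight t) ≤ 2 * ℓ
    lgW≤ = subst (λ w → lg w ≤ 2 * ℓ) (sym weight≡) (lg-suc n 2≤n)
  in begin
  c                                                  ≤⟨ Run-bound ℓ λ′ lgW≤ (⌈log₂⌉-mono-≤ 2≤n) (m≤n⊔m 1 (lg ℓ)) 1≤λ run ⟩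
  2 * Φ t + m * (198 * (ℓ * λ′))                     ≤⟨ +-monoˡ-≤ _ (*-monoʳ-≤ 2 (Φ≤ t (weight t) ≤-refl)) ⟩
  2 * (length (inorder t) * lg (weight t)) + m * (198 * (ℓ * λ′))
    ≡⟨ cong (λ x → 2 * (x * lg (weight t)) + m * (198 * (ℓ * λ′))) size ⟩
  2 * (n * lg (weight t)) + m * (198 * (ℓ * λ′))     ≤⟨ +-monoˡ-≤ _ (*-monoʳ-≤ 2 (*-monoʳ-≤ n lgW≤)) ⟩
  2 * (n * (2 * ℓ)) + m * (198 * (ℓ * λ′))           ≡⟨ eq₁ n m ℓ λ′ ⟩
  -- The initial potential contributes only `4 * n * ℓ`. The maximum with `1` in `lglg` keeps `λ′`
  -- positive even at `n = 2`, so this fits under the per-access constant `198`.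
  4 * (n * (ℓ * 1)) + m * (198 * (ℓ * λ′))           ≤⟨ +-monoˡ-≤ _ (*-mono-≤ (m≤m+n 4 194) (*-monoʳ-≤ n (*-monoʳ-≤ ℓ 1≤λ))) ⟩
  198 * (n * (ℓ * λ′)) + m * (198 * (ℓ * λ′))        ≡⟨ eq₂ n m ℓ λ′ ⟩
  198 * (n + m) * ℓ * λ′                             ∎
  where
  eq₁ : ∀ n m l x → 2 * (n * (2 * l)) + m * (198 * (l * x)) ≡ 4 * (n * (l * 1)) + m * (198 * (l * x))
  eq₁ = solve-∀
  eq₂ : ∀ n m l x → 198 * (n * (l * x)) + m * (198 * (l * x)) ≡ 198 * (n + m) * l * x
  eq₂ = solve-∀
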